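{- Every hypergame $x$ has a non-losing strategy for at least one of the players L, R, I, II.
   Context: Hypergames: work in a universe of possibly non-wellfounded sets (set theory with the Antifoundation Axiom, and the Axiom of Choice). The class $\mathcal H$ of hypergames (also called games) is the carrier of the final coalgebra $(\mathcal H,\mathrm{id})$ of the functor $F(A)=\mathcal P(A)\times\mathcal P(A)$ on the category of classes and functional classes, where $\mathcal P$ is the powerset functor. Thus a hypergame is a pair $x=(X^L,X^R)$ of sets of hypergames; elements $x^L\in X^L$ and $x^R\in X^R$ are the Left and Right options of $x$. Positions of $x$ are the hypergames hereditarily reachable from $x$. Plays: L (Left) and R (Right) move alternately; either may start. Player I is the one who starts, player II the other one; LI means L acting as player I, and similarly LII, RI, RII. A play on $x$ is a (possibly empty) finite or infinite sequence $x_1^{K_1}x_2^{K_2}\cdots$ with $K_i\in\{L,R\}$ and $K_{i+1}\neq K_i$, such that, with $x_0=x$ and $x_i=(X_i^L,X_i^R)$, one has $x_{i+1}\in X_i^{K_{i+1}}$ for all $i\ge 0$. A finite play is winning for L (resp. R) if it ends with a position $y=(Y^L,Y^R)$ where R (resp. L) is next to move but $Y^R=\emptyset$ (resp. $Y^L=\emptyset$); the empty play ends at $x$ with the starting player next to move. Every infinite play is a draw. A play is non-losing for L (resp. R) if it is winning for L (resp. R) or is a draw. Strategies: for P in $\{$LI, LII, RI, RII$\}$ let $\mathrm{FPlay}^P_x$ be the set of finite plays on $x$ in which P has the prescribed role (first or second player) and is next to move (the empty play is included exactly when P is LI or RI). A strategy for P on $x$ is a partial function $f$ from $\mathrm{FPlay}^P_x$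 to positions of $x$ such that $f(\pi)=x'$ implies that $\pi x'$ is a play, and $f(\pi)$ is defined whenever some $\pi x'$ is a play. The opponent of LI is RII, and of LII is RI (and conversely). A play $\pi$ is coherent with $f$ if for each proper prefix $\pi'$ of $\pi$ where P is next to move, $f(\pi')=x'$ implies $\pi'x'$ is a prefix of $\pi$. For a strategy $f$ for P and a strategy $f'$ for the opponent, $f*f'$ is the unique maximal play coherent with both. $f$ is non-losing (winning) for P if $f*f'$ is non-losing (winning) for P (i.e. for L or R accordingly) for every strategy $f'$ of the opponent. A strategy for L is a pair of strategies for LI and LII; for R, for RI and RII; for I, for LI and RI; for II, for LII and RII. Such a pair is non-losing (winning) if both components are. -}

module Defs where

open import Data.Empty.Polymorphic using (⊥)
open import Data.List.Base using (List; []; _∷_; _∷ʳ_; length; applyUpTo)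
open import Data.List.Relation.Binary.Pointwise using (Pointwise)
open import Data.List.Relation.Binary.Prefix.Heterogeneous using (Prefix)
open import Data.Maybe.Base using (Maybe; just)
import Data.Maybe.Relation.Binary.Pointwise as Maybe
open import Data.Nat.Base using (ℕ)
open import Data.Product.Base using (Σ-syntax; ∃-syntax; _×_; _,_)
open import Data.Sum.Base using (_⊎_)
open import Data.Unit.Polymorphic using (⊤)
open import Function.Bundles using (Func; _⟨$⟩_)
open import Level using (Level; suc; _⊔_)
open import Relation.Binary.Bundles using (Setoid)
open import Relation.Binary.Core using (Rel; REL)
open import Relation.Binary.Definitions using (_Respectsˡ_; _Respectsʳ_)
open import Relation.Binary.PropositionalEquality.Core using (_≡_; refl)
open import Relation.Binary.Structures using (IsEquivalence)
open import Relation.Nullary.Negation.Core using (¬_)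

-- The axiom of choice of set theory. A set is rendered as a setoid, so the
-- choice function must respect the equality of its domain.
AxiomOfChoice : ∀ ℓ → Set (suc ℓ)
AxiomOfChoice ℓ =
  (A B : Setoid ℓ ℓ) (let module A = Setoid A; module B = Setoid B) →
  (_∼_ : REL A.Carrier B.Carrier ℓ) →
  _∼_ Respectsˡ A._≈_ → _∼_ Respectsʳ B._≈_ →
  (∀ x → ∃[ y ] x ∼ y) →
  Σ[ f ∈ Func A B ] ∀ x → x ∼ (f ⟨$⟩ x)

-- A set of elements of A, presented as a family indexed by a type in Set ℓ
-- (possibly with repetitions). With Set ℓ as the universe of sets, the
-- inhabitants of Set (suc ℓ) play the role of classes.
record ℘ {a} (ℓ : Level) (A : Set a) : Set (suc ℓ ⊔ a) where
  field
    Index : Set ℓ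
    elem  : Index → A

open ℘ public

-- The two agents that move. The players L, R, I, II are defined below.
data Mover : Set where
  L R : Mover

opp : Mover → Mover
opp L = R
opp R = L

-- The final coalgebra of A ↦ ℘ A × ℘ A. Its equality is bisimilarity, _≈_.
record Hypergame (ℓ : Level) : Set (suc ℓ) where
  coinductive
  field
    left right : ℘ ℓ (Hypergame ℓ)

open Hypergame public

options : ∀ {ℓ} → Mover → Hypergame ℓ → ℘ ℓ (Hypergame ℓ)
options L = left
options R = right

record IsBisimulation {ℓ r} (_∼_ : Rel (Hypergame ℓ) r) : Set (suc ℓ ⊔ r) where
  field
    forth : ∀ {x y} → x ∼ y → ∀ K (i : Index (options K x)) →
            ∃[ j ] elem (options K x) i ∼ elem (options K y) j
    back  : ∀ {x y} → x ∼ y → ∀ K (j : Index (options K y)) →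
            ∃[ i ] elem (options K x) i ∼ elem (options K y) j

open IsBisimulation

infix 4 _≈_ _∈_

_≈_ : ∀ {ℓ} → Rel (Hypergame ℓ) (suc (suc ℓ))
_≈_ {ℓ} x y = Σ[ _∼_ ∈ Rel (Hypergame ℓ) (suc ℓ) ] (IsBisimulation _∼_ × x ∼ y)

≈-isBisimulation : ∀ {ℓ} → IsBisimulation (_≈_ {ℓ})
≈-isBisimulation .forth (_∼_ , b , r) K i =
  let j , s = forth b r K i in j , _∼_ , b , s
≈-isBisimulation .back (_∼_ , b , r) K j =
  let i , s = back b r K j in i , _∼_ , b , s

≈-isEquivalence : ∀ {ℓ} → IsEquivalence (_≈_ {ℓ})
≈-isEquivalence .IsEquivalence.refl = _≡_ , isBisim , refl
  where
  isBisim : IsBisimulation _≡_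
  isBisim .forth refl K i = i , refl
  isBisim .back  refl K j = j , refl
≈-isEquivalence .IsEquivalence.sym (_∼_ , b , r) = (λ x y → y ∼ x) , isBisim , r
  where
  isBisim : IsBisimulation (λ x y → y ∼ x)
  isBisim .forth = back b
  isBisim .back  = forth b
≈-isEquivalence .IsEquivalence.trans (_∼₁_ , b₁ , r₁) (_∼₂_ , b₂ , r₂) =
  (λ x z → ∃[ y ] (x ∼₁ y × y ∼₂ z)) , isBisim , _ , r₁ , r₂
  where
  isBisim : IsBisimulation (λ x z → ∃[ y ] (x ∼₁ y × y ∼₂ z))
  isBisim .forth (_ , s₁ , s₂) K i =
    let j , t₁ = forth b₁ s₁ K i ; k , t₂ = forth b₂ s₂ K j in k , _ , t₁ , t₂
  isBisim .back (_ , s₁ , s₂) K k =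
    let j , t₂ = back b₂ s₂ K k ; i , t₁ = back b₁ s₁ K j in i , _ , t₁ , t₂

_∈_ : ∀ {ℓ} → Hypergame ℓ → ℘ ℓ (Hypergame ℓ) → Set (suc (suc ℓ))
y ∈ X = ∃[ i ] elem X i ≈ y

Empty : ∀ {ℓ} → ℘ ℓ (Hypergame ℓ) → Set (suc (suc ℓ))
Empty X = ∀ y → ¬ (y ∈ X)

-- The positions x₁, x₂, … of a play, without the initial x₀. The labels Kᵢ
-- alternate, hence are determined by the mover who starts; that mover is a
-- separate parameter (S below), which also settles who is next to move in the
-- empty play.
data Sequence (ℓ : Level) : Set (suc ℓ) where
  fin : List (Hypergame ℓ) → Sequence ℓ
  inf : (ℕ → Hypergame ℓ) → Sequence ℓ

next : ∀ {ℓ} → Mover → List (Hypergame ℓ) → Mover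
next S []       = S
next S (_ ∷ xs) = next (opp S) xs

end : ∀ {ℓ} → Hypergame ℓ → List (Hypergame ℓ) → Hypergame ℓ
end x []       = x
end x (y ∷ ys) = end y ys

data IsFinitePlay {ℓ} (S : Mover) (x : Hypergame ℓ) :
                  List (Hypergame ℓ) → Set (suc (suc ℓ)) where
  []  : IsFinitePlay S x []
  _∷_ : ∀ {y ys} → y ∈ options S x → IsFinitePlay (opp S) y ys →
        IsFinitePlay S x (y ∷ ys)

IsPlay : ∀ {ℓ} → Mover → Hypergame ℓ → Sequence ℓ → Set (suc (suc ℓ))
IsPlay S x (fin xs) = IsFinitePlay S x xs
IsPlay S x (inf s)  = ∀ n → IsFinitePlay S x (applyUpTo s n)

IsWinning : ∀ {ℓ} → Mover → Mover → Hypergame ℓ → Sequence ℓ → Set (suc (suc ℓ))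
IsWinning K S x (fin xs) = next S xs ≡ opp K × Empty (options (opp K) (end x xs))
IsWinning K S x (inf s)  = ⊥

IsDraw : ∀ {ℓ} → Sequence ℓ → Set (suc (suc ℓ))
IsDraw (fin _) = ⊥
IsDraw (inf _) = ⊤

IsNonLosing : ∀ {ℓ} → Mover → Mover → Hypergame ℓ → Sequence ℓ → Set (suc (suc ℓ))
IsNonLosing K S x π = IsWinning K S x π ⊎ IsDraw π

infix 4 _⊑_ _⊏_ _≼_ _≋_

_⊑_ : ∀ {ℓ} → List (Hypergame ℓ) → Sequence ℓ → Set (suc (suc ℓ))
xs ⊑ fin ys = Prefix _≈_ xs ys
xs ⊑ inf s  = Pointwise _≈_ xs (applyUpTo s (length xs))

_⊏_ : ∀ {ℓ} → List (Hypergame ℓ) → Sequence ℓ → Set (suc (suc ℓ))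
xs ⊏ π = ∃[ y ] (xs ∷ʳ y) ⊑ π

-- π is an initial segment of ρ; both may be infinite.
_≼_ : ∀ {ℓ} → Rel (Sequence ℓ) (suc (suc ℓ))
π ≼ ρ = ∀ xs → xs ⊑ π → xs ⊑ ρ

_≋_ : ∀ {ℓ} → Rel (Sequence ℓ) (suc (suc ℓ))
π ≋ ρ = π ≼ ρ × ρ ≼ π

data Role : Set where
  LI LII RI RII : Role

mover starter : Role → Mover
mover LI  = L
mover LII = L
mover RI  = R
mover RII = R

starter LI  = L
starter LII = R
starter RI  = R
starter RII = L

opponent : Role → Role
opponent LI  = RII
opponent LII = RI
opponent RI  = LII
opponent RII = LI

record FPlay {ℓ} (P : Role) (x : Hypergame ℓ) : Set (suc (suc ℓ)) where
  field
    positions : List (Hypergame ℓ)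
    isPlay    : IsFinitePlay (starter P) x positions
    toMove    : next (starter P) positions ≡ mover P

open FPlay public

-- A partial function is a function into Maybe; cong says that it is well
-- defined on plays up to equality of hypergames.
record Strategy {ℓ} (P : Role) (x : Hypergame ℓ) : Set (suc (suc ℓ)) where
  field
    choose : FPlay P x → Maybe (Hypergame ℓ)
    cong   : ∀ {π ρ} → Pointwise _≈_ (positions π) (positions ρ) →
             Maybe.Pointwise _≈_ (choose π) (choose ρ)
    sound  : ∀ π {y} → choose π ≡ just y →
             IsFinitePlay (starter P) x (positions π ∷ʳ y)
    total  : ∀ π {y} → IsFinitePlay (starter P) x (positions π ∷ʳ y) →
             ∃[ z ] choose π ≡ just z

open Strategy public

module _ {ℓ} {x : Hypergame ℓ} where

  IsCoherent : ∀ {P} → Strategy P x → Sequence ℓ → Set (suc (suc ℓ))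
  IsCoherent f π = ∀ π′ {y} → positions π′ ⊏ π → choose f π′ ≡ just y →
                   (positions π′ ∷ʳ y) ⊑ π

  module _ {P} (f : Strategy P x) (f′ : Strategy (opponent P) x) where

    IsCoherentPlay : Sequence ℓ → Set (suc (suc ℓ))
    IsCoherentPlay π = IsPlay (starter P) x π × IsCoherent f π × IsCoherent f′ π

    IsMaximalCoherentPlay : Sequence ℓ → Set (suc (suc ℓ))
    IsMaximalCoherentPlay π =
      IsCoherentPlay π × (∀ ρ → IsCoherentPlay ρ → π ≼ ρ → ρ ≼ π)

    -- π = f * f′
    IsOutcome : Sequence ℓ → Set (suc (suc ℓ))
    IsOutcome π =
      IsMaximalCoherentPlay π × (∀ ρ → IsMaximalCoherentPlay ρ → π ≋ ρ)

  -- f * f′ is a definite description: its existence is part of the claim.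
  IsNonLosingStrategy : ∀ {P} → Strategy P x → Set (suc (suc ℓ))
  IsNonLosingStrategy {P} f =
    ∀ (f′ : Strategy (opponent P) x) →
    ∃[ π ] (IsOutcome f f′ π × IsNonLosing (mover P) (starter P) x π)

data Player : Set where
  L R I II : Player

role₁ role₂ : Player → Role
role₁ L  = LI
role₁ R  = RI
role₁ I  = LI
role₁ II = LII

role₂ L  = LII
role₂ R  = RII
role₂ I  = RI
role₂ II = RII

PlayerStrategy : ∀ {ℓ} → Player → Hypergame ℓ → Set (suc (suc ℓ))
PlayerStrategy p x = Strategy (role₁ p) x × Strategy (role₂ p) x

IsNonLosingPlayerStrategy : ∀ {ℓ} p {x : Hypergame ℓ} → PlayerStrategy p x → Set (suc (suc ℓ))
IsNonLosingPlayerStrategy p (f , g) = IsNonLosingStrategy f × IsNonLosingStrategy g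

{-# OPTIONS --safe #-}
module Submission where

-- Say that M loses at x if M is to move there and the other mover can force a
-- win. If M does not lose at x, then M has a non-losing strategy as player I:
-- always move to an option from which the other mover cannot force a win. If M
-- loses at x, then M cannot force a win there, so in the same way the other
-- mover has a non-losing strategy as player II. The alternatives for M = L and
-- M = R combine to the four players. These strategies depend only on the
-- current position, and positions are named by finite paths, which form a set,
-- so the axiom of choice applies.

open import Axiom.ExcludedMiddle using (ExcludedMiddle)
open import Data.Empty using (⊥-elim)
open import Data.List.Base using (List; []; _∷_; _∷ʳ_; length; applyUpTo)
open import Data.List.Properties using (length-applyUpTo; applyUpTo-∷ʳ)
open import Data.List.Relation.Binary.Pointwise.Base using (Pointwise; []; _∷_)
import Data.List.Relation.Binary.Pointwise as Pointwise
open import Data.List.Relation.Binary.Prefix.Heterogeneous using (Prefix; []; _∷_; _++ᵖ_)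
import Data.List.Relation.Binary.Prefix.Heterogeneous.Properties as Prefix
open import Data.List.Reverse using (Reverse; []; _∶_∶ʳ_; reverseView)
open import Data.Maybe.Base using (Maybe; just; nothing)
import Data.Maybe.Relation.Binary.Pointwise as Maybe
open import Data.Nat.Base as ℕ using (ℕ; zero; _+_; _∸_)
open import Data.Nat.Properties using (≤-total; m∸n+n≡m)
open import Data.Product.Base using (Σ-syntax; ∃-syntax; _×_; _,_; proj₁; proj₂)
open import Data.Sum.Base using (_⊎_; inj₁; inj₂)
open import Function.Base using (_∘_; id)
open import Function.Bundles using (Func; _⟨$⟩_)
open import Level using (Level; suc; Lift; lift; lower)
open import Relation.Binary.Bundles using (Setoid)
open import Relation.Binary.PropositionalEquality as ≡
  using (_≡_; refl; sym; trans; subst)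
open import Relation.Binary.Structures using (IsEquivalence)
open import Relation.Nullary.Decidable using (Dec; yes; no; True; toWitness; fromWitness; map′; decidable-stable)
open import Relation.Nullary.Negation using (¬_; contradiction)
open import Defs

private
  variable
    ℓ : Level
    K M S : Mover
    x x′ y y′ z : Hypergame ℓ
    xs ys : List (Hypergame ℓ)

module ≈ {ℓ : Level} = IsEquivalence (≈-isEquivalence {ℓ})
open IsBisimulation

-- Movers and roles

opp-involutive : ∀ M → opp (opp M) ≡ M
opp-involutive L = refl
opp-involutive R = refl

opp-irreflexive : ∀ M → ¬ (M ≡ opp M)
opp-irreflexive L ()
opp-irreflexive R ()

turn : ∀ M K → M ≡ K ⊎ M ≡ opp K
turn L L = inj₁ refl
turn L R = inj₂ refl
turn R L = inj₂ refl
turn R R = inj₁ refl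

starter-opponent : ∀ P → starter (opponent P) ≡ starter P
starter-opponent LI  = refl
starter-opponent LII = refl
starter-opponent RI  = refl
starter-opponent RII = refl

mover-opponent : ∀ P → mover (opponent P) ≡ opp (mover P)
mover-opponent LI  = refl
mover-opponent LII = refl
mover-opponent RI  = refl
mover-opponent RII = refl

-- Plays and bisimilarity

∈-resp-≈ : ∀ M → x ≈ x′ → y ≈ y′ → y ∈ options M x → y′ ∈ options M x′
∈-resp-≈ M e e′ (i , d) =
  let j , r = forth ≈-isBisimulation e M i
  in  j , ≈.trans (≈.sym r) (≈.trans d e′)

IsFinitePlay-resp-≈ : x ≈ x′ → Pointwise _≈_ xs ys →
                      IsFinitePlay S x xs → IsFinitePlay S x′ ys
IsFinitePlay-resp-≈         e []       []       = []
IsFinitePlay-resp-≈ {S = S} e (d ∷ ds) (y∈ ∷ p) =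
  ∈-resp-≈ S e d y∈ ∷ IsFinitePlay-resp-≈ d ds p

next-cong : Pointwise _≈_ xs ys → next S xs ≡ next S ys
next-cong []       = refl
next-cong (_ ∷ ds) = next-cong ds

next-∷ʳ : ∀ S (xs : List (Hypergame ℓ)) → next S (xs ∷ʳ y) ≡ opp (next S xs)
next-∷ʳ S []       = refl
next-∷ʳ S (_ ∷ xs) = next-∷ʳ (opp S) xs

end-cong : x ≈ x′ → Pointwise _≈_ xs ys → end x xs ≈ end x′ ys
end-cong e []       = e
end-cong e (d ∷ ds) = end-cong d ds

end-∷ʳ : ∀ (x : Hypergame ℓ) xs → end x (xs ∷ʳ y) ≡ y
end-∷ʳ x []       = refl
end-∷ʳ x (z ∷ xs) = end-∷ʳ z xs

snoc⁺ : ∀ xs → IsFinitePlay S x xs → y ∈ options (next S xs) (end x xs) →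
        IsFinitePlay S x (xs ∷ʳ y)
snoc⁺ []       []       y∈ = y∈ ∷ []
snoc⁺ (_ ∷ xs) (z∈ ∷ p) y∈ = z∈ ∷ snoc⁺ xs p y∈

snoc⁻ : ∀ xs → IsFinitePlay S x (xs ∷ʳ y) → y ∈ options (next S xs) (end x xs)
snoc⁻ []       (y∈ ∷ [])  = y∈
snoc⁻ (_ ∷ xs) (z∈ ∷ p)   = snoc⁻ xs p

-- Initial segments of sequences

⊑-init : ∀ xs (ρ : Sequence ℓ) → (xs ∷ʳ y) ⊑ ρ → xs ⊑ ρ
⊑-init []       (fin _)        _       = []
⊑-init []       (inf _)        _       = []
⊑-init (_ ∷ xs) (fin (_ ∷ ys)) (d ∷ p) = d ∷ ⊑-init xs (fin ys) p
-- Dropping the first position leaves the sequence shifted by one, which is how `applyUpTo` unfolds.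
⊑-init (_ ∷ xs) (inf s)        (d ∷ p) = d ∷ ⊑-init xs (inf (s ∘ ℕ.suc)) p

⊑-last-unique : ∀ xs (ρ : Sequence ℓ) → (xs ∷ʳ y) ⊑ ρ → (xs ∷ʳ z) ⊑ ρ → y ≈ z
⊑-last-unique []       (fin (_ ∷ _))  (d ∷ _) (e ∷ _) = ≈.trans d (≈.sym e)
⊑-last-unique []       (inf s)        (d ∷ _) (e ∷ _) = ≈.trans d (≈.sym e)
⊑-last-unique (_ ∷ xs) (fin (_ ∷ ys)) (_ ∷ p) (_ ∷ q) = ⊑-last-unique xs (fin ys) p q
⊑-last-unique (_ ∷ xs) (inf s)        (_ ∷ p) (_ ∷ q) = ⊑-last-unique xs (inf (s ∘ ℕ.suc)) p q

Prefix-isFinitePlay : x ≈ x′ → Prefix _≈_ xs ys →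
                      IsFinitePlay S x ys → IsFinitePlay S x′ xs
Prefix-isFinitePlay         e []       _        = []
Prefix-isFinitePlay {S = S} e (d ∷ ds) (y∈ ∷ p) =
  ∈-resp-≈ S e (≈.sym d) y∈ ∷ Prefix-isFinitePlay (≈.sym d) ds p

⊑-isFinitePlay : ∀ (ρ : Sequence ℓ) → IsPlay S x ρ → xs ⊑ ρ → IsFinitePlay S x xs
⊑-isFinitePlay           (fin _) p xs⊑ = Prefix-isFinitePlay ≈.refl xs⊑ p
⊑-isFinitePlay {xs = xs} (inf s) p xs⊑ =
  IsFinitePlay-resp-≈ ≈.refl (Pointwise.symmetric ≈.sym xs⊑) (p (length xs))

Prefix-∷ʳ⁻ : ∀ ys → Prefix _≈_ xs (ys ∷ʳ y) →
             Prefix _≈_ xs ys ⊎ Pointwise _≈_ xs (ys ∷ʳ y)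
Prefix-∷ʳ⁻ []       []       = inj₁ []
Prefix-∷ʳ⁻ (_ ∷ _)  []       = inj₁ []
Prefix-∷ʳ⁻ []       (d ∷ []) = inj₂ (d ∷ [])
Prefix-∷ʳ⁻ (_ ∷ ys) (d ∷ p)  with Prefix-∷ʳ⁻ ys p
... | inj₁ q = inj₁ (d ∷ q)
... | inj₂ q = inj₂ (d ∷ q)

-- The outcome of two opposing strategies

FinitePlay : Mover → Hypergame ℓ → Set (suc (suc ℓ))
FinitePlay S x = ∃[ xs ] IsFinitePlay S x xs

module Outcome {ℓ : Level} {P : Role} {x : Hypergame ℓ}
               (f : Strategy P x) (f′ : Strategy (opponent P) x) where

  -- Evidence for whose turn it is. `prescribe` takes it as an argument, so facts about the
  -- prescribed move are proved by cases on arbitrary evidence, without unfolding `toMove?`.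
  data Turn (xs : List (Hypergame ℓ)) : Set where
    own   : next (starter P) xs ≡ mover P → Turn xs
    other : next (starter P) xs ≡ opp (mover P) → Turn xs

  asFPlay : (π : FinitePlay (starter P) x) →
            next (starter P) (proj₁ π) ≡ mover P → FPlay P x
  asFPlay (xs , p) e = record { positions = xs ; isPlay = p ; toMove = e }

  asFPlay′ : (π : FinitePlay (starter P) x) →
             next (starter P) (proj₁ π) ≡ opp (mover P) → FPlay (opponent P) x
  asFPlay′ (xs , p) e = record
    { positions = xs
    ; isPlay    = subst (λ S → IsFinitePlay S x xs) (sym (starter-opponent P)) p
    ; toMove    = trans (≡.cong (λ S → next S xs) (starter-opponent P))
                        (trans e (sym (mover-opponent P)))
    }

  prescribe : (π : FinitePlay (starter P) x) → Turn (proj₁ π) → Maybe (Hypergame ℓ)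
  prescribe π (own e) = choose f (asFPlay π e)
  prescribe π (other e) = choose f′ (asFPlay′ π e)

  toMove? : (π : FinitePlay (starter P) x) → Turn (proj₁ π)
  toMove? π with turn (next (starter P) (proj₁ π)) (mover P)
  ... | inj₁ e = own e
  ... | inj₂ e = other e

  move : FinitePlay (starter P) x → Maybe (Hypergame ℓ)
  move π = prescribe π (toMove? π)

  not-both : ∀ {xs : List (Hypergame ℓ)} → next (starter P) xs ≡ mover P →
             ¬ (next (starter P) xs ≡ opp (mover P))
  not-both e e′ = opp-irreflexive (mover P) (trans (sym e) e′)

  toMove′ : (π : FPlay (opponent P) x) → next (starter P) (positions π) ≡ opp (mover P)
  toMove′ π = trans (≡.cong (λ S → next S (positions π)) (sym (starter-opponent P)))
                    (trans (toMove π) (mover-opponent P))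

  -- Bisimilar plays have the same mover to move, so the evidence cannot name the other side; what
  -- remains is congruence of `f`. This transfers a choice of `f` to the run whatever evidence is in
  -- use there.
  prescribe-choose : ∀ (π : FPlay P x) ρ t →
                     Pointwise _≈_ (positions π) (proj₁ ρ) →
                     Maybe.Pointwise _≈_ (choose f π) (prescribe ρ t)
  prescribe-choose π ρ (own e) d = Strategy.cong f d
  prescribe-choose π ρ (other e) d =
    contradiction e (not-both {proj₁ ρ} (trans (sym (next-cong d)) (toMove π)))

  prescribe-choose′ : ∀ (π : FPlay (opponent P) x) ρ t →
                      Pointwise _≈_ (positions π) (proj₁ ρ) →
                      Maybe.Pointwise _≈_ (choose f′ π) (prescribe ρ t)
  prescribe-choose′ π ρ (other e) d = Strategy.cong f′ d
  prescribe-choose′ π ρ (own e) d =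
    contradiction (trans (sym (next-cong d)) (toMove′ π)) (not-both {proj₁ ρ} e)

  prescribe-cong : ∀ π ρ t u → Pointwise _≈_ (proj₁ π) (proj₁ ρ) →
                   Maybe.Pointwise _≈_ (prescribe π t) (prescribe ρ u)
  prescribe-cong π ρ (own e) = prescribe-choose (asFPlay π e) ρ
  prescribe-cong π ρ (other e) = prescribe-choose′ (asFPlay′ π e) ρ

  prescribe-sound : ∀ π t {y} → prescribe π t ≡ just y →
                    IsFinitePlay (starter P) x (proj₁ π ∷ʳ y)
  prescribe-sound π (own e) eq = sound f (asFPlay π e) eq
  prescribe-sound π (other e) eq =
    subst (λ S → IsFinitePlay S x _) (starter-opponent P) (sound f′ (asFPlay′ π e) eq)

  prescribe-total : ∀ π t {y} → IsFinitePlay (starter P) x (proj₁ π ∷ʳ y) →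
                    ∃[ z ] prescribe π t ≡ just z
  prescribe-total π (own e) p = total f (asFPlay π e) p
  prescribe-total π (other e) p =
    total f′ (asFPlay′ π e) (subst (λ S → IsFinitePlay S x _) (sym (starter-opponent P)) p)

  prescribe-coherent : ∀ π t {y} (ρ : Sequence ℓ) → IsCoherent f ρ → IsCoherent f′ ρ →
                       proj₁ π ⊏ ρ → prescribe π t ≡ just y → (proj₁ π ∷ʳ y) ⊑ ρ
  prescribe-coherent π (own e) ρ c c′ = c (asFPlay π e)
  prescribe-coherent π (other e) ρ c c′ = c′ (asFPlay′ π e)

  -- Staying put when no move is prescribed makes run total, and eventually
  -- constant if the outcome is finite.
  advance : ∀ π m → move π ≡ m → FinitePlay (starter P) x
  advance π (just y) eq = proj₁ π ∷ʳ y , prescribe-sound π (toMove? π) eq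
  advance π nothing  eq = π

  run : ℕ → FinitePlay (starter P) x
  run zero    = [] , []
  run (ℕ.suc n) = advance (run n) (move (run n)) refl

  trace : ℕ → List (Hypergame ℓ)
  trace n = proj₁ (run n)

  advance-just : ∀ π m eq {y} → m ≡ just y → proj₁ (advance π m eq) ≡ proj₁ π ∷ʳ y
  advance-just π _ eq refl = refl

  -- The equality covers the whole play, its validity proof included, so that `move` can be applied
  -- to both sides.
  advance-nothing : ∀ π m eq → m ≡ nothing → advance π m eq ≡ π
  advance-nothing π _ eq refl = refl

  trace-just : ∀ n {y} → move (run n) ≡ just y → trace (ℕ.suc n) ≡ trace n ∷ʳ y
  trace-just n = advance-just (run n) _ refl

  run-invariant : ∀ {i} (Inv : FinitePlay (starter P) x → Set i) → Inv ([] , []) →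
                  (∀ π {y} (q : IsFinitePlay (starter P) x (proj₁ π ∷ʳ y)) →
                     move π ≡ just y → Inv π → Inv (proj₁ π ∷ʳ y , q)) →
                  ∀ n → Inv (run n)
  run-invariant Inv base step zero    = base
  run-invariant Inv base step (ℕ.suc n) =
    go (move (run n)) refl (run-invariant Inv base step n)
    where
    -- The move is abstracted along with its equation: `advance` then reduces, and the equation is
    -- still at hand for `step`.
    go : ∀ m eq → Inv (run n) → Inv (advance (run n) m eq)
    go (just y) eq = step (run n) _ eq
    go nothing  eq = id

  -- Up to bisimilarity, the finite initial segments of `π` are exactly the stages of the run. This
  -- treats finite and infinite outcomes alike, so coherence and maximality are proved only once.
  Represents : Sequence ℓ → Set (suc (suc ℓ))
  Represents π = (∀ xs → xs ⊑ π → ∃[ n ] Pointwise _≈_ xs (trace n)) ×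
                 (∀ xs n → Pointwise _≈_ xs (trace n) → xs ⊑ π)

  module _ {π : Sequence ℓ} (rep : Represents π) where

    extend-⊑ : ∀ {xs} n {m y z} → Pointwise _≈_ xs (trace n) → m ≡ just y → z ≈ y →
               Maybe.Pointwise _≈_ m (move (run n)) → (xs ∷ʳ z) ⊑ π
    extend-⊑ {xs} n {z = z} d refl z≈y q with _ , eq , e ← Maybe.just-inv q =
      proj₂ rep (xs ∷ʳ z) (ℕ.suc n)
        (subst (Pointwise _≈_ (xs ∷ʳ z)) (sym (trace-just n eq))
          (Pointwise.++⁺ d (≈.trans z≈y e ∷ [])))

    coherent : IsCoherent f π
    coherent ρ (_ , ρy⊑π) eq
      with n , d ← proj₁ rep (positions ρ) (⊑-init (positions ρ) π ρy⊑π) =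
      extend-⊑ n d eq ≈.refl (prescribe-choose ρ (run n) (toMove? (run n)) d)

    coherent′ : IsCoherent f′ π
    coherent′ ρ (_ , ρy⊑π) eq
      with n , d ← proj₁ rep (positions ρ) (⊑-init (positions ρ) π ρy⊑π) =
      extend-⊑ n d eq ≈.refl (prescribe-choose′ ρ (run n) (toMove? (run n)) d)

    -- Induction on initial segments, removing the last position: a coherent play that has followed
    -- the run so far can only continue by the prescribed move. Both maximality and uniqueness of
    -- the outcome follow.
    greatest : ∀ ρ → IsCoherentPlay f f′ ρ → ρ ≼ π
    greatest ρ (play , c , c′) xs = go (reverseView xs)
      where
      go : ∀ {xs} → Reverse xs → xs ⊑ ρ → xs ⊑ π
      go []              _      = proj₂ rep [] zero []
      go (ys ∶ r ∶ʳ z) ysz⊑ρ =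
        let ys⊑ρ   = ⊑-init ys ρ ysz⊑ρ
            n , d  = proj₁ rep ys (go r ys⊑ρ)
            σ      = ys , ⊑-isFinitePlay ρ play ys⊑ρ
            t      = toMove? σ
            -- The continuation by `z` shows that a legal move exists, so a move is prescribed;
            -- coherence then places it in `ρ`, where it must agree with `z`.
            _ , eq = prescribe-total σ t (⊑-isFinitePlay ρ play ysz⊑ρ)
            ysy⊑ρ  = prescribe-coherent σ t ρ c c′ (z , ysz⊑ρ) eq
        in  extend-⊑ n d eq (⊑-last-unique ys ρ ysz⊑ρ ysy⊑ρ)
              (prescribe-cong σ (run n) t (toMove? (run n)) d)

    isOutcome : IsPlay (starter P) x π → IsOutcome f f′ π
    isOutcome play =
      (coherentPlay , λ ρ p _ → greatest ρ p) ,
      λ ρ (p , maximal) → maximal π coherentPlay (greatest ρ p) , greatest ρ p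
      where
      coherentPlay : IsCoherentPlay f f′ π
      coherentPlay = play , coherent , coherent′

  module Halting (N : ℕ) (halts : move (run N) ≡ nothing) where

    run-stable : ∀ k → run (k + N) ≡ run N
    run-stable zero      = refl
    run-stable (ℕ.suc k) =
      trans (advance-nothing (run (k + N)) _ refl (trans (≡.cong move (run-stable k)) halts))
            (run-stable k)

    traces-grow : ∀ n k → Prefix _≈_ (trace n) (trace (k + n))
    traces-grow n zero      = Prefix.fromPointwise (Pointwise.refl ≈.refl)
    traces-grow n (ℕ.suc k) = go (move (run (k + n))) refl
      where
      go : ∀ m eq → Prefix _≈_ (trace n) (proj₁ (advance (run (k + n)) m eq))
      go (just y) eq = traces-grow n k ++ᵖ (y ∷ [])
      go nothing  eq = traces-grow n k

    trace⊑ : ∀ n → Prefix _≈_ (trace n) (trace N)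
    trace⊑ n with ≤-total n N
    ... | inj₁ n≤N = subst (λ k → Prefix _≈_ (trace n) (trace k)) (m∸n+n≡m n≤N)
                       (traces-grow n (N ∸ n))
    ... | inj₂ N≤n = Prefix.fromPointwise (Pointwise.reflexive ≈.reflexive
                       (Pointwise.≡⇒Pointwise-≡ (≡.cong proj₁
                         (subst (λ k → run k ≡ run N) (m∸n+n≡m N≤n) (run-stable (n ∸ N))))))

    -- Each stage adds at most one position, so the run skips no length.
    ⊑trace : ∀ n {xs} → Prefix _≈_ xs (trace n) → ∃[ k ] Pointwise _≈_ xs (trace k)
    ⊑trace zero      []  = zero , []
    ⊑trace (ℕ.suc n) xs⊑ = go (move (run n)) refl xs⊑
      where
      go : ∀ m eq {xs} → Prefix _≈_ xs (proj₁ (advance (run n) m eq)) →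
           ∃[ k ] Pointwise _≈_ xs (trace k)
      go nothing  eq xs⊑ = ⊑trace n xs⊑
      go (just y) eq xs⊑ with Prefix-∷ʳ⁻ (trace n) xs⊑
      ... | inj₁ xs⊑n = ⊑trace n xs⊑n
      ... | inj₂ d    = ℕ.suc n , subst (Pointwise _≈_ _) (sym (trace-just n eq)) d

    represents : Represents (fin (trace N))
    represents = (λ _ → ⊑trace N) ,
                 (λ _ n d → Prefix.trans ≈.trans (Prefix.fromPointwise d) (trace⊑ n))

    -- An option at the end would give a legal extension, and totality would then prescribe a move.
    end-empty : Empty (options (next (starter P) (trace N)) (end x (trace N)))
    end-empty y y∈
      with _ , eq ← prescribe-total (run N) (toMove? (run N))
                      (snoc⁺ (trace N) (proj₂ (run N)) y∈)
      with () ← trans (sym halts) eq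

  module Endless (endless : ∀ n → ∃[ y ] move (run n) ≡ just y) where

    s : ℕ → Hypergame ℓ
    s n = proj₁ (endless n)

    trace≡ : ∀ n → trace n ≡ applyUpTo s n
    trace≡ zero      = refl
    trace≡ (ℕ.suc n) = trans (trace-just n (proj₂ (endless n)))
                         (trans (≡.cong (_∷ʳ s n) (trace≡ n)) (applyUpTo-∷ʳ s n))

    isPlay-s : IsPlay (starter P) x (inf s)
    isPlay-s n = subst (IsFinitePlay (starter P) x) (trace≡ n) (proj₂ (run n))

    represents : Represents (inf s)
    proj₁ represents xs xs⊑ =
      length xs , subst (Pointwise _≈_ xs) (sym (trace≡ (length xs))) xs⊑
    proj₂ represents xs n d =
      -- An endless run has exactly `n` positions at stage `n`, so `n` is the length that the order
      -- on infinite sequences asks for.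
      subst (λ k → Pointwise _≈_ xs (applyUpTo s k)) n≡ d′
      where
      d′ : Pointwise _≈_ xs (applyUpTo s n)
      d′ = subst (Pointwise _≈_ xs) (trace≡ n) d
      n≡ : n ≡ length xs
      n≡ = sym (trans (Pointwise.Pointwise-length d′) (length-applyUpTo s n))

-- Forced wins

-- Inductive, hence least: a forced win is a well-founded tree of moves, and infinite play never
-- counts as won. The base case is `loses` at a position without options. Quantifying over indices
-- keeps both predicates in `Set ℓ`.
data Wins  (M : Mover) (x : Hypergame ℓ) : Set ℓ
data Loses (M : Mover) (x : Hypergame ℓ) : Set ℓ

data Wins M x where
  wins : ∀ i → Loses (opp M) (elem (options M x) i) → Wins M x

data Loses M x where
  loses : (∀ i → Wins (opp M) (elem (options M x) i)) → Loses M x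

-- The winning move of one derivation is answered by the other; repeating this descends through
-- both, which is impossible forever.
wins⇒¬loses : Wins M x → ¬ Loses M x
wins⇒¬loses (wins i l) (loses w) = wins⇒¬loses (w i) l

Wins-resp-≈  : x ≈ y → Wins M x → Wins M y
Loses-resp-≈ : x ≈ y → Loses M x → Loses M y

Wins-resp-≈ {M = M} e (wins i l) =
  let j , d = forth ≈-isBisimulation e M i in wins j (Loses-resp-≈ d l)

Loses-resp-≈ {M = M} e (loses w) = loses λ j →
  let i , d = back ≈-isBisimulation e M j in Wins-resp-≈ d (w i)

∈-loses⇒wins : y ∈ options M x → Loses (opp M) y → Wins M x
∈-loses⇒wins (i , e) l = wins i (Loses-resp-≈ (≈.sym e) l)

-- With M to move at x, the mover other than K cannot force a win.
Safe : Mover → Mover → Hypergame ℓ → Set ℓ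
Safe K M x = (M ≡ K → ¬ Loses M x) × (M ≡ opp K → ¬ Wins M x)

safe-first : ∀ M {x : Hypergame ℓ} → ¬ Loses M x → Safe M M x
safe-first M ¬loses = (λ _ → ¬loses) , λ e → contradiction e (opp-irreflexive M)

safe-second : ∀ M {x : Hypergame ℓ} → Loses M x → Safe (opp M) M x
safe-second M l = (λ e → contradiction e (opp-irreflexive M)) , λ _ w → wins⇒¬loses w l

-- A move of the other mover keeps `K` safe by itself, since reaching a position lost for `K` would
-- have been a forced win. Only the moves of `K` need the hypothesis `preserves`.
Safe-step : y ∈ options M x → (M ≡ K → ¬ Loses M x → ¬ Wins (opp M) y) →
            Safe K M x → Safe K (opp M) y
Safe-step {M = M} {K = K} y∈ preserves (¬loses , ¬wins) = ¬loses′ , ¬wins′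
  where
  ¬loses′ : opp M ≡ K → ¬ Loses (opp M) _
  ¬loses′ e l = ¬wins (trans (sym (opp-involutive M)) (≡.cong opp e)) (∈-loses⇒wins y∈ l)
  ¬wins′ : opp M ≡ opp K → ¬ Wins (opp M) _
  ¬wins′ e = preserves M≡K (¬loses M≡K)
    where
    M≡K : M ≡ K
    M≡K = trans (sym (opp-involutive M)) (trans (≡.cong opp e) (opp-involutive K))

PreservesSafety : ∀ {P} {x : Hypergame ℓ} → Strategy P x → Set (suc (suc ℓ))
PreservesSafety {P = P} {x = x} f =
  ∀ π {y} → choose f π ≡ just y →
  ¬ Loses (mover P) (end x (positions π)) → ¬ Wins (opp (mover P)) y

-- Positions as a set

-- The hypergames themselves live in Set (suc ℓ), the paths to them in Set ℓ.

data Position (x : Hypergame ℓ) : Set ℓ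
⟦_⟧ : {x : Hypergame ℓ} → Position x → Hypergame ℓ

data Position x where
  root : Position x
  step : (p : Position x) (M : Mover) → Index (options M ⟦ p ⟧) → Position x

⟦_⟧ {x = x} root = x
⟦ step p M i ⟧   = elem (options M ⟦ p ⟧) i

-- Moves of a play are options only up to bisimilarity, so the path is rebuilt step by step and ends
-- at a bisimilar game.
locate : (p : Position x) → ⟦ p ⟧ ≈ y → IsFinitePlay S y xs →
         ∃[ q ] ⟦_⟧ {x = x} q ≈ end y xs
locate p e [] = p , e
locate {S = S} p e (z∈ ∷ π) with i , d ← ∈-resp-≈ S (≈.sym e) ≈.refl z∈ =
  locate (step p S i) d π

-- From safety to non-losing strategies

module _ {ℓ : Level} (em : ExcludedMiddle (suc (suc ℓ))) where

  decide : (A : Set ℓ) → Dec A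
  decide A = map′ lower lift (em {Lift (suc (suc ℓ)) A})

  ¬wins-option : ∀ {M} {x : Hypergame ℓ} → ¬ Loses M x →
                 ∃[ i ] ¬ Wins (opp M) (elem (options M x) i)
  ¬wins-option ¬loses = decidable-stable (decide _) λ none →
    ¬loses (loses λ i → decidable-stable (decide _) λ ¬wins → none (i , ¬wins))

  -- Excluded middle decides whether the run of the two strategies ever halts. An endless run is a
  -- draw; a halting one ends where the mover has no option, and safety, which holds all along the
  -- run, determines who that is.
  preservesSafety⇒nonLosing : ∀ {P} {x : Hypergame ℓ} (f : Strategy P x) → PreservesSafety f →
                              Safe (mover P) (starter P) x → IsNonLosingStrategy f
  preservesSafety⇒nonLosing {P} {x} f preserves safe f′
    with em {Lift (suc (suc ℓ)) (∃[ N ] Outcome.move f f′ (Outcome.run f f′ N) ≡ nothing)}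
  ... | yes (lift (N , halts)) =
        fin (trace N) , isOutcome {π = fin (trace N)} represents (proj₂ (run N)) ,
        inj₁ (winning (toMove? (run N)))
    where
    open Outcome f f′
    open Halting N halts

    Inv : FinitePlay (starter P) x → Set ℓ
    Inv (xs , _) = Safe (mover P) (next (starter P) xs) (end x xs)

    inv-step : ∀ π {y} (q : IsFinitePlay (starter P) x (proj₁ π ∷ʳ y)) →
               move π ≡ just y → Inv π → Inv (proj₁ π ∷ʳ y , q)
    inv-step π {y} q eq inv
      rewrite next-∷ʳ {y = y} (starter P) (proj₁ π) | end-∷ʳ {y = y} x (proj₁ π) =
      Safe-step (snoc⁻ (proj₁ π) q) (go (toMove? π) eq) inv
      where
      go : ∀ t → prescribe π t ≡ just y → next (starter P) (proj₁ π) ≡ mover P →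
           ¬ Loses (next (starter P) (proj₁ π)) (end x (proj₁ π)) →
           ¬ Wins (opp (next (starter P) (proj₁ π))) y
      go (own e)   eq e′ = subst (λ M → ¬ Loses M (end x (proj₁ π)) → ¬ Wins (opp M) y)
                             (sym e) (preserves (asFPlay π e) eq)
      go (other e) eq e′ = contradiction e (not-both {proj₁ π} e′)

    winning : Turn (trace N) → IsWinning (mover P) (starter P) x (fin (trace N))
    -- A mover without options loses vacuously, against safety at the last position.
    winning (own e) = contradiction
      (loses λ i → ⊥-elim (end-empty _ (i , ≈.refl)))
      (proj₁ (run-invariant Inv safe inv-step N) e)
    winning (other e) = e , subst (λ M → Empty (options M (end x (trace N)))) e end-empty
  ... | no ¬halts = inf s , isOutcome {π = inf s} represents isPlay-s , inj₂ _
    where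
    open Outcome f f′

    endless : ∀ n → ∃[ y ] move (run n) ≡ just y
    endless n = go (move (run n)) refl
      where
      go : ∀ m → move (run n) ≡ m → ∃[ y ] move (run n) ≡ just y
      go (just y) eq = y , eq
      go nothing  eq = contradiction (lift (n , eq)) ¬halts

    open Endless endless

  -- Excluded middle resizes propositions to Set ℓ; bisimilarity needs this
  -- in order to be the equality of a setoid that the axiom of choice accepts.
  Resize : Set (suc (suc ℓ)) → Set ℓ
  Resize A = Lift ℓ (True (em {A}))

  resize : {A : Set (suc (suc ℓ))} → A → Resize A
  resize a = lift (fromWitness a)

  unresize : {A : Set (suc (suc ℓ))} → Resize A → A
  unresize (lift t) = toWitness t

  positionSetoid : Hypergame ℓ → Setoid ℓ ℓ
  positionSetoid x = record
    { Carrier       = Position x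
    ; _≈_           = λ p q → Resize (⟦ p ⟧ ≈ ⟦ q ⟧)
    ; isEquivalence = record
      { refl  = resize ≈.refl
      ; sym   = λ e → resize (≈.sym (unresize e))
      ; trans = λ e d → resize (≈.trans (unresize e) (unresize d))
      }
    }

  -- Vacuous when y has no option for K, since the axiom of choice wants a value
  -- at every position.
  GoodMove : Mover → (y z : Hypergame ℓ) → Set (suc (suc ℓ))
  GoodMove K y z = Index (options K y) →
                   z ∈ options K y × (¬ Loses K y → ¬ Wins (opp K) z)

  GoodMove-resp-≈ : ∀ {K} {y y′ z z′ : Hypergame ℓ} → y ≈ y′ → z ≈ z′ →
                    GoodMove K y z → GoodMove K y′ z′
  GoodMove-resp-≈ {K} e d good i =
    let j , _      = back ≈-isBisimulation e K i
        z∈ , ¬wins = good j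
    in  ∈-resp-≈ K e d z∈ ,
        λ ¬loses w → ¬wins (¬loses ∘ Loses-resp-≈ e) (Wins-resp-≈ (≈.sym d) w)

  goodMove : ∀ K {x : Hypergame ℓ} (p : Position x) → ∃[ q ] GoodMove K ⟦ p ⟧ (⟦_⟧ {x = x} q)
  goodMove K p with decide (Index (options K ⟦ p ⟧)) | decide (Loses K ⟦ p ⟧)
  -- Without options the condition is void, and `p` is a dummy value.
  ... | no ¬i | _          = p , λ i → contradiction i ¬i
  ... | yes i | yes l      = step p K i , λ _ → (i , ≈.refl) , λ ¬loses → contradiction l ¬loses
  ... | yes _ | no ¬loses with i , ¬wins ← ¬wins-option ¬loses =
    step p K i , λ _ → (i , ≈.refl) , λ _ → ¬wins

  -- Positional strategies from the axiom of choice

  module _ (choice : AxiomOfChoice ℓ) where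

    module Positional (K : Mover) (x : Hypergame ℓ) where

      -- The choice function respects bisimilarity of the positions that paths name; this is what
      -- makes the resulting strategy well defined on plays up to bisimilarity.
      chosen : Σ[ g ∈ Func (positionSetoid x) (positionSetoid x) ]
               ∀ p → Resize (GoodMove K ⟦ p ⟧ ⟦ g ⟨$⟩ p ⟧)
      chosen = choice (positionSetoid x) (positionSetoid x)
        (λ p q → Resize (GoodMove K ⟦ p ⟧ ⟦ q ⟧))
        (λ e good → resize (GoodMove-resp-≈ (unresize e) ≈.refl (unresize good)))
        (λ d good → resize (GoodMove-resp-≈ ≈.refl (unresize d) (unresize good)))
        (λ p → let q , good = goodMove K p in q , resize good)

      target : Position x → Hypergame ℓ
      target p = ⟦ proj₁ chosen ⟨$⟩ p ⟧

      target-cong : ∀ {p q} → ⟦ p ⟧ ≈ ⟦ q ⟧ → target p ≈ target q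
      target-cong e = unresize (Func.cong (proj₁ chosen) (resize e))

      reply : Position x → Maybe (Hypergame ℓ)
      reply p with decide (Index (options K ⟦ p ⟧))
      ... | yes _ = just (target p)
      ... | no _  = nothing

      reply-cong : ∀ p q → ⟦ p ⟧ ≈ ⟦ q ⟧ → Maybe.Pointwise _≈_ (reply p) (reply q)
      reply-cong p q e with decide (Index (options K ⟦ p ⟧)) | decide (Index (options K ⟦ q ⟧))
      ... | yes _ | yes _ = Maybe.just (target-cong {p} {q} e)
      ... | yes i | no ¬j = contradiction (proj₁ (forth ≈-isBisimulation e K i)) ¬j
      ... | no ¬i | yes j = contradiction (proj₁ (back ≈-isBisimulation e K j)) ¬i
      ... | no _  | no _  = Maybe.nothing

      reply-good : ∀ p {y} → reply p ≡ just y →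
                   y ∈ options K ⟦ p ⟧ × (¬ Loses K ⟦ p ⟧ → ¬ Wins (opp K) y)
      reply-good p eq with decide (Index (options K ⟦ p ⟧))
      reply-good p refl | yes i = unresize (proj₂ chosen p) i

      reply-total : ∀ p {y} → y ∈ options K ⟦ p ⟧ → ∃[ z ] reply p ≡ just z
      reply-total p (i , _) with decide (Index (options K ⟦ p ⟧))
      ... | yes _ = target p , refl
      ... | no ¬i = contradiction i ¬i

    module _ (P : Role) (x : Hypergame ℓ) where

      open Positional (mover P) x

      located : (π : FPlay P x) → ∃[ p ] ⟦_⟧ {x = x} p ≈ end x (positions π)
      located π = locate root ≈.refl (isPlay π)

      positional : Strategy P x
      choose positional π = reply (proj₁ (located π))
      Strategy.cong positional {π} {ρ} d =
        -- The two paths may differ, but they name bisimilar positions, and `reply` depends on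
        -- nothing else.
        let p , e = located π ; q , e′ = located ρ
        in  reply-cong p q (≈.trans e (≈.trans (end-cong ≈.refl d) (≈.sym e′)))
      sound positional π eq =
        let p , e = located π
            y∈    = ∈-resp-≈ (mover P) e ≈.refl (proj₁ (reply-good p eq))
        in  snoc⁺ (positions π) (isPlay π)
              (subst (λ M → _ ∈ options M (end x (positions π))) (sym (toMove π)) y∈)
      total positional π q =
        let p , e = located π
            y∈    = subst (λ M → _ ∈ options M (end x (positions π))) (toMove π)
                      (snoc⁻ (positions π) q)
        in  reply-total p (∈-resp-≈ (mover P) (≈.sym e) ≈.refl y∈)

      positional-preservesSafety : PreservesSafety positional
      positional-preservesSafety π eq ¬loses =
        let p , e = located π
        in  proj₂ (reply-good p eq) (¬loses ∘ Loses-resp-≈ e)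

      positional-nonLosing : Safe (mover P) (starter P) x → IsNonLosingStrategy positional
      positional-nonLosing =
        preservesSafety⇒nonLosing positional positional-preservesSafety

    nonLosing : ∀ p (x : Hypergame ℓ) →
                Safe (mover (role₁ p)) (starter (role₁ p)) x →
                Safe (mover (role₂ p)) (starter (role₂ p)) x →
                ∃[ p ] Σ[ s ∈ PlayerStrategy p x ] IsNonLosingPlayerStrategy p s
    nonLosing p x safe₁ safe₂ =
      p , (positional (role₁ p) x , positional (role₂ p) x) ,
      positional-nonLosing (role₁ p) x safe₁ , positional-nonLosing (role₂ p) x safe₂

theorem2p13 : ∀ {ℓ} → ExcludedMiddle (suc (suc ℓ)) → AxiomOfChoice ℓ →
    (x : Hypergame ℓ) →
    ∃[ p ] Σ[ s ∈ PlayerStrategy p x ] IsNonLosingPlayerStrategy p s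
theorem2p13 em choice x with decide em (Loses L x) | decide em (Loses R x)
-- A mover who does not lose is safe when starting; a mover who loses makes the opposite mover safe
-- as second player. Each case thus supplies exactly the two roles of one player.
... | no ¬l | no ¬r = nonLosing em choice I  x (safe-first L ¬l) (safe-first R ¬r)
... | no ¬l | yes r = nonLosing em choice L  x (safe-first L ¬l) (safe-second R r)
... | yes l | no ¬r = nonLosing em choice R  x (safe-first R ¬r) (safe-second L l)
... | yes l | yes r = nonLosing em choice II x (safe-second R r) (safe-second L l)
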